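{- Let $k\geq 2$ and let $T$ be a $(2k+1)$-strong tournament such that every arc of $T$ has a 2-bypass (i.e. for every arc $uv$ of $T$ there is a vertex $w$ with $uw$ and $wv$ arcs of $T$). Then $T$ is $(k+1)^{*}$-strongly connected.
   Context: A tournament is a digraph in which each pair of distinct vertices is joined by exactly one arc. A digraph is $m$-strong if it has more than $m$ vertices and remains strongly connected after deleting any set of fewer than $m$ vertices. For distinct vertices $u,v$ of a digraph $D$, a strong $k^{*}$-container between $u$ and $v$ is a set of $k$ internally disjoint paths that are either all $(u,v)$-paths or all $(v,u)$-paths, whose union contains every vertex of $D$. $D$ is $k^{*}$-strongly connected if there is a strong $k^{*}$-container between every two distinct vertices of $D$. -}

module Defs where

open import Data.Fin using (Fin)
open import Data.Fin.Subset using (Subset; ∣_∣; _∉_)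
open import Data.List using (List; _∷_; _∷ʳ_)
open import Data.List.Membership.Propositional using (_∈_)
open import Data.List.Relation.Binary.Disjoint.Propositional using (Disjoint)
open import Data.List.Relation.Unary.All using (All)
open import Data.List.Relation.Unary.Linked using (Linked)
open import Data.List.Relation.Unary.Unique.Propositional using (Unique)
open import Data.Nat using (ℕ; _<_)
open import Data.Product using (∃-syntax; _×_)
open import Data.Sum using (_⊎_)
open import Function using (_∘_)
open import Function.Definitions using (Injective)
open import Level using (0ℓ)
open import Relation.Binary using (Rel; Decidable)
open import Relation.Binary.PropositionalEquality using (_≡_; _≢_)
open import Relation.Nullary using (¬_)

record Digraph (n : ℕ) : Set₁ where
  field
    Arc      : Rel (Fin n) 0ℓ
    arc?     : Decidable Arc
    loopless : ∀ v → ¬ Arc v v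

module _ {n : ℕ} (D : Digraph n) where
  open Digraph D

  IsTournament : Set
  IsTournament = ∀ u v → u ≢ v → (Arc u v × ¬ Arc v u) ⊎ (¬ Arc u v × Arc v u)

  -- Only paths with at least one arc are represented: `unique` forces u ≢ v.
  record Path (u v : Fin n) : Set where
    field
      interior : List (Fin n)

    vertices : List (Fin n)
    vertices = u ∷ (interior ∷ʳ v)

    field
      linked : Linked Arc vertices
      unique : Unique vertices

  open Path

  -- Strong connectivity of D - S. A pair of equal vertices is joined by the
  -- trivial path, so only distinct pairs are constrained.
  StronglyConnectedWithout : Subset n → Set
  StronglyConnectedWithout S =
    ∀ u v → u ∉ S → v ∉ S → u ≢ v → ∃[ p ] All (_∉ S) (vertices {u} {v} p)

  IsStrong : ℕ → Set
  IsStrong m = m < n × (∀ (S : Subset n) → ∣ S ∣ < m → StronglyConnectedWithout S)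

  EveryArcHas2Bypass : Set
  EveryArcHas2Bypass = ∀ u v → Arc u v → ∃[ w ] (Arc u w × Arc w v)

  -- `distinct` makes the family a set of exactly k paths; `disjoint` alone
  -- would allow the one-arc path u v, whose interior is empty, to be repeated.
  record Container (k : ℕ) (u v : Fin n) : Set where
    field
      paths    : Fin k → Path u v
      distinct : Injective _≡_ _≡_ (interior ∘ paths)
      disjoint : ∀ i j → i ≢ j → Disjoint (interior (paths i)) (interior (paths j))
      spanning : ∀ w → ∃[ i ] w ∈ vertices (paths i)

  StrongContainer : ℕ → Fin n → Fin n → Set
  StrongContainer k u v = Container k u v ⊎ Container k v u

  IsStarStronglyConnected : ℕ → Set
  IsStarStronglyConnected k = ∀ u v → u ≢ v → StrongContainer k u v

{-# OPTIONS --safe #-}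

-- One of the two ordered pairs (s,t) formed by the given vertices is not an arc. By Menger's
-- theorem there are k + 3 ≤ 2k + 1 internally disjoint (s,t)-paths, whose interiors are
-- nonempty since s t is not an arc. Leftover vertices are inserted into the interiors
-- as long as possible. A leftover vertex w that fits nowhere satisfies last p → w or
-- w → first p for every interior p, so contracting s, t and the interiors to a single vertex z
-- gives a strong semicomplete digraph on z and the leftover vertices. Its Hamiltonian cycle
-- (Camion) is a path through all leftover vertices that starts where some interior ends (or at s)
-- and ends where some interior starts (or at t); splicing it in, possibly in two parts, joins at
-- most three interiors into one. Finally, any two disjoint interiors merge into one as in merge
-- sort, which brings the number of paths down to exactly k + 1.
module Submission where

open import Data.Empty using (⊥; ⊥-elim)
open import Data.Fin using (Fin; zero; suc; _≟_)
open import Data.Fin.Subset as Subset using (Subset; ⁅_⁆; _∪_; ⋃; ∣_∣; inside; outside)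
import Data.Fin.Subset.Properties as Subset
open import Data.List using (List; []; _∷_; _++_; _∷ʳ_; length; map; concatMap; filter; allFin; cartesianProduct; lookup)
open import Data.List.Membership.Propositional using (_∈_; _∉_; find; lose)
open import Data.List.Membership.Propositional.Properties
open import Data.List.Properties using (length-++; length-map; length-filter; ++-identityʳ; ++-assoc; ∷-injective; ∷-injectiveˡ; ∷-injectiveʳ)
open import Data.List.Relation.Binary.Disjoint.Propositional using (Disjoint)
open import Data.List.Relation.Binary.Permutation.Propositional
open import Data.List.Relation.Binary.Permutation.Propositional.Properties using (All-resp-↭; Any-resp-↭; ∈-resp-↭; ↭-map-inv; ↭-length; ++⁺; ++⁺ˡ; ++⁺ʳ; ++-comm; shift; shifts; ++-commutativeMonoid)
import Data.List.Relation.Binary.Permutation.Setoid.Properties as PermutationSetoid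
open import Data.List.Relation.Unary.All as All using (All; []; _∷_)
import Data.List.Relation.Unary.All.Properties as All
open import Data.List.Relation.Unary.AllPairs using ([]; _∷_)
open import Data.List.Relation.Unary.Any as Any using (Any; here; there; any?)
open import Data.List.Relation.Unary.Any.Properties using (lookup-index)
open import Data.List.Relation.Unary.Linked using (Linked; [-]; _∷_)
open import Data.List.Relation.Unary.Unique.Propositional using (Unique)
import Data.List.Relation.Unary.Unique.Propositional.Properties as Unique
open import Data.Maybe using (Maybe; just; nothing)
open import Data.Nat using (ℕ; zero; suc; _+_; _*_; _≤_; _<_; z≤n; s≤s; s≤s⁻¹)
open import Data.Nat.Properties using (≤-refl; ≤-reflexive; ≤-trans; ≤-<-connex; <⇒≱; suc-injective; +-identityʳ; +-suc; +-comm; +-assoc; +-mono-≤; +-monoʳ-≤; +-monoˡ-≤; m≤n+m; m<m+n; m≤n⇒∃[o]m+o≡n; module ≤-Reasoning)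
open import Data.Product using (∃-syntax; Σ-syntax; _×_; _,_; proj₁; proj₂)
open import Data.Sum using (_⊎_; inj₁; inj₂)
open import Data.Unit using (⊤; tt)
open import Data.Vec using ([]; _∷_)
open import Function using (_∘_; id)
open import Level using (0ℓ)
open import Relation.Binary using (Rel)
open import Relation.Binary.PropositionalEquality using (_≡_; _≢_; refl; sym; cong; cong₂; subst; setoid) renaming (trans to ≡-trans)
open import Relation.Nullary using (¬_; Dec; yes; no; contradiction; ¬?)
open import Relation.Nullary.Decidable using (_×-dec_; _⊎-dec_; toSum)
open import Relation.Unary using (Pred; Decidable)
open import Defs

-- Lists up to permutation.

module _ {a} {A : Set a} where

  interchange : (ws xs ys zs : List A) → (ws ++ xs) ++ ys ++ zs ↭ (ws ++ ys) ++ xs ++ zs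
  interchange = solve 4 (λ w x y z → (w ⊕ x) ⊕ y ⊕ z ⊜ (w ⊕ y) ⊕ x ⊕ z) refl
    where open import Algebra.Solver.CommutativeMonoid (++-commutativeMonoid {A = A})

  Unique-resp-↭ : {xs ys : List A} → xs ↭ ys → Unique xs → Unique ys
  Unique-resp-↭ p = PermutationSetoid.Unique-resp-↭ (setoid A) (↭⇒↭ₛ p)

  Unique-++⁻ : ∀ xs {ys : List A} → Unique (xs ++ ys) → Unique xs × Unique ys × Disjoint xs ys
  Unique-++⁻ []       u       = [] , u , λ { (() , _) }
  Unique-++⁻ (x ∷ xs) (p ∷ u) with Unique-++⁻ xs u
  ... | uxs , uys , xs#ys = All.++⁻ˡ xs p ∷ uxs , uys , λ where
    (here refl , y∈) → All.lookup (All.++⁻ʳ xs p) y∈ refl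
    (there x∈  , y∈) → xs#ys (x∈ , y∈)

  ∈⇒↭ : ∀ {x} {xs : List A} → x ∈ xs → ∃[ ys ] xs ↭ x ∷ ys
  ∈⇒↭ x∈xs with ∈-∃++ x∈xs
  ... | ys , zs , refl = ys ++ zs , shift _ ys zs

  unique-⊆⇒↭ : ∀ {xs ys : List A} → Unique xs → (∀ {z} → z ∈ xs → z ∈ ys) →
               ∃[ zs ] ys ↭ xs ++ zs
  unique-⊆⇒↭ {[]}             []      sub = _ , refl
  unique-⊆⇒↭ {x ∷ xs} {ys} (p ∷ u) sub with ∈⇒↭ (sub (here refl))
  ... | ys′ , ys↭ with unique-⊆⇒↭ u sub′
    where
    sub′ : ∀ {z} → z ∈ xs → z ∈ ys′
    sub′ z∈ with ∈-resp-↭ ys↭ (sub (there z∈))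
    ... | here refl = contradiction refl (All.lookup p z∈)
    ... | there z∈′ = z∈′
  ... | zs , ys′↭ = zs , trans ys↭ (prep x ys′↭)

  -- By counting, the remainder left by `unique-⊆⇒↭` is empty.
  unique-⊆-length⇒↭ : ∀ {xs ys : List A} → Unique xs → (∀ {z} → z ∈ xs → z ∈ ys) →
                      length ys ≤ length xs → xs ↭ ys
  unique-⊆-length⇒↭ {xs} {ys} u sub len with unique-⊆⇒↭ u sub
  ... | []     , ys↭ = ↭-sym (trans ys↭ (↭-reflexive (++-identityʳ xs)))
  ... | z ∷ zs , ys↭ = contradiction longer (<⇒≱ shorter)
    where
    shorter : length xs < length (xs ++ z ∷ zs)
    shorter = ≤-trans (m<m+n (length xs) (s≤s z≤n)) (≤-reflexive (sym (length-++ xs)))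
    longer : length (xs ++ z ∷ zs) ≤ length xs
    longer = ≤-trans (≤-reflexive (↭-length (↭-sym ys↭))) len

  split : ∀ {p q} {P : Pred A p} {Q : Pred A q} {xs : List A} →
          (∀ {x} → x ∈ xs → P x ⊎ Q x) →
          (∃[ x ] ∃[ ys ] xs ↭ x ∷ ys × P x) ⊎ All Q xs
  split {xs = []}     f = inj₂ []
  split {xs = x ∷ xs} f with f (here refl) | split (f ∘ there)
  ... | inj₁ p | _                          = inj₁ (x , xs , refl , p)
  ... | inj₂ _ | inj₁ (y , ys , xs↭ , p)    = inj₁ (y , x ∷ ys , trans (prep x xs↭) (swap x y refl) , p)
  ... | inj₂ q | inj₂ qs                    = inj₂ (q ∷ qs)

-- Chains and families of links.

-- Vertices may repeat: distinctness is imposed later by `Unique` on the vertex list, which is an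
-- index so that it can be handled up to `↭`.
data Chain {V : Set} (R : Rel V 0ℓ) : V → V → List V → Set where
  [_] : ∀ x → Chain R x x (x ∷ [])
  _∷_ : ∀ {x y z l} → R x y → Chain R y z l → Chain R x z (x ∷ l)

module _ {V : Set} {R : Rel V 0ℓ} where

  front rest : ∀ {x y l} → Chain R x y l → List V
  front [ _ ]             = []
  front (_∷_ {x} _ c)     = x ∷ front c
  rest  [ _ ]             = []
  rest  (_∷_ {l = l} _ _) = l

  first∷rest : ∀ {x y l} (c : Chain R x y l) → l ≡ x ∷ rest c
  first∷rest [ _ ]   = refl
  first∷rest (_ ∷ _) = refl

  last∷front : ∀ {x y l} (c : Chain R x y l) → l ↭ y ∷ front c
  last∷front [ _ ]         = refl
  last∷front (_∷_ {x} _ c) = trans (prep x (last∷front c)) (swap x _ refl)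

  first∈verts : ∀ {x y l} → Chain R x y l → x ∈ l
  first∈verts [ _ ]   = here refl
  first∈verts (_ ∷ _) = here refl

  last∈verts : ∀ {x y l} → Chain R x y l → y ∈ l
  last∈verts c = ∈-resp-↭ (↭-sym (last∷front c)) (here refl)

  join : ∀ {x y z w l m} → Chain R x y l → R y z → Chain R z w m → Chain R x w (l ++ m)
  join [ _ ]   e d = e ∷ d
  join (f ∷ c) e d = f ∷ join c e d

  glue : ∀ {x y z l m} → Chain R x y l → (d : Chain R y z m) → Chain R x z (l ++ rest d)
  glue [ _ ]   [ y ]   = [ y ]
  glue [ _ ]   (e ∷ d) = e ∷ d
  glue (f ∷ c) d       = f ∷ glue c d

  All-rest : ∀ {P : Pred V 0ℓ} {x y l} (c : Chain R x y l) → All P l → All P (rest c)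
  All-rest [ _ ]   _        = []
  All-rest (_ ∷ _) (_ ∷ ps) = ps

  -- `P` is asked only of `front c`, because in use the chain may end in the very separator that `P`
  -- avoids.
  prefixAvoiding : ∀ {P : Pred V 0ℓ} {x y w l} (c : Chain R x y l) → All P (front c) →
                   w ∈ l → P w → ∃[ m ] Chain R x w m × All P m
  prefixAvoiding [ x ]   _        (here refl) pw = _ , [ x ] , pw ∷ []
  prefixAvoiding (e ∷ c) _        (here refl) pw = _ , [ _ ] , pw ∷ []
  prefixAvoiding (e ∷ c) (p ∷ ps) (there w∈)  pw with prefixAvoiding c ps w∈ pw
  ... | m , d , qs = _ , e ∷ d , p ∷ qs

  suffixAvoiding : ∀ {P : Pred V 0ℓ} {x y w l} (c : Chain R x y l) → All P (rest c) →
                   w ∈ l → P w → ∃[ m ] Chain R w y m × All P m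
  suffixAvoiding [ x ]   _  (here refl) pw = _ , [ x ] , pw ∷ []
  suffixAvoiding (e ∷ c) ps (here refl) pw = _ , e ∷ c , pw ∷ ps
  suffixAvoiding (e ∷ c) ps (there w∈)  pw = suffixAvoiding c (All-rest c ps) w∈ pw

chain-map : ∀ {V : Set} {R R′ : Rel V 0ℓ} → (∀ {x y} → R x y → R′ x y) →
            ∀ {x y l} → Chain R x y l → Chain R′ x y l
chain-map f [ x ]   = [ x ]
chain-map f (e ∷ c) = f e ∷ chain-map f c

record Link {V : Set} (R : Rel V 0ℓ) (A B : Pred V 0ℓ) : Set where
  constructor link
  field
    {first last} : V
    {verts}      : List V
    chain        : Chain R first last verts
    first∈       : A first
    last∈        : B last

open Link

module _ {V : Set} {R : Rel V 0ℓ} {A B : Pred V 0ℓ} where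

  flat : List (Link R A B) → List V
  flat = concatMap verts

  fronts rests : List (Link R A B) → List V
  fronts = concatMap (front ∘ chain)
  rests  = concatMap (rest ∘ chain)

  flat-↭ : ∀ {ps qs} → ps ↭ qs → flat ps ↭ flat qs
  flat-↭ refl         = refl
  flat-↭ (prep p r)   = ++⁺ˡ (verts p) (flat-↭ r)
  flat-↭ (swap p q r) = trans (shifts (verts p) (verts q)) (++⁺ˡ (verts q) (++⁺ˡ (verts p) (flat-↭ r)))
  flat-↭ (trans r r′) = trans (flat-↭ r) (flat-↭ r′)

  ∈-flat⁻ : ∀ ps {w} → w ∈ flat ps → ∃[ p ] p ∈ ps × w ∈ verts p
  ∈-flat⁻ (p ∷ ps) w∈ with ∈-++⁻ (verts p) w∈
  ... | inj₁ w∈p = p , here refl , w∈p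
  ... | inj₂ w∈ps with ∈-flat⁻ ps w∈ps
  ...   | q , q∈ , w∈q = q , there q∈ , w∈q

  ∈-concatMap⁺′ : ∀ (f : Link R A B → List V) {ps p w} → p ∈ ps → w ∈ f p → w ∈ concatMap f ps
  ∈-concatMap⁺′ f (here refl)          w∈ = ∈-++⁺ˡ w∈
  ∈-concatMap⁺′ f {q ∷ _} (there p∈)   w∈ = ∈-++⁺ʳ (f q) (∈-concatMap⁺′ f p∈ w∈)

  flat↭lasts++fronts : ∀ ps → flat ps ↭ map last ps ++ fronts ps
  flat↭lasts++fronts []       = refl
  flat↭lasts++fronts (p ∷ ps) =
    trans (++⁺ (last∷front (chain p)) (flat↭lasts++fronts ps))
          (prep _ (shifts (front (chain p)) (map last ps)))

  flat↭firsts++rests : ∀ ps → flat ps ↭ map first ps ++ rests ps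
  flat↭firsts++rests []       = refl
  flat↭firsts++rests (p ∷ ps) =
    trans (++⁺ (↭-reflexive (first∷rest (chain p))) (flat↭firsts++rests ps))
          (prep _ (shifts (rest (chain p)) (map first ps)))

-- Links are paired by position, and the vertex shared by a pair is counted once, hence `rests qs`
-- in place of `flat qs`.
glueAll : ∀ {V : Set} {R : Rel V 0ℓ} {A B C D : Pred V 0ℓ}
          (ps : List (Link R A C)) (qs : List (Link R D B)) → map last ps ≡ map first qs →
          Σ[ rs ∈ List (Link R A B) ] flat rs ↭ flat ps ++ rests qs × length rs ≡ length ps
glueAll []                    []                    _  = [] , refl , refl
glueAll (link {verts = l} c a _ ∷ ps) (link d _ b ∷ qs) eq with ∷-injective eq
... | refl , eq′ with glueAll ps qs eq′
...   | rs , rs↭ , len = link (glue c d) a b ∷ rs , perm , cong suc len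
  where
  perm : (l ++ rest d) ++ flat rs ↭ (l ++ flat ps) ++ rest d ++ rests qs
  perm = trans (++⁺ˡ (l ++ rest d) rs↭) (interchange l (rest d) (flat ps) (rests qs))

module _ {V : Set} {R R′ : Rel V 0ℓ} {A B : Pred V 0ℓ} (f : ∀ {x y} → R x y → R′ x y) where

  weaken : Link R A B → Link R′ A B
  weaken (link c a b) = link (chain-map f c) a b

  flat-weaken : ∀ ps → flat (map weaken ps) ≡ flat ps
  flat-weaken []       = refl
  flat-weaken (p ∷ ps) = cong (verts p ++_) (flat-weaken ps)

-- Menger's theorem.

module _ {n : ℕ} where

  open import Data.List.Membership.DecPropositional (_≟_ {n}) using (_∈?_)

  E⟨_⟩ : List (Fin n × Fin n) → Rel (Fin n) 0ℓ
  E⟨ es ⟩ x y = (x , y) ∈ es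

  Linkage : List (Fin n × Fin n) → Pred (Fin n) 0ℓ → Pred (Fin n) 0ℓ → ℕ → Set
  Linkage es A B k = Σ[ ps ∈ List (Link E⟨ es ⟩ A B) ] Unique (flat ps) × k ≤ length ps

  -- `S` may contain vertices of `A` and `B`, and one-vertex chains count: this is the vertex form
  -- of separation, for sets that may overlap.
  Separates : List (Fin n × Fin n) → Pred (Fin n) 0ℓ → Pred (Fin n) 0ℓ → List (Fin n) → Set
  Separates es A B S = ∀ {a b l} → Chain E⟨ es ⟩ a b l → A a → B b → ¬ All (_∉ S) l

  module _ {es : List (Fin n × Fin n)} {A B : Pred (Fin n) 0ℓ} {x y : Fin n} {S : List (Fin n)}
           (sep : Separates es A B S) where

    -- A chain from `A` to `B` that avoids `S` must use the new arc, hence pass through `x`. So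
    -- every such chain meets `x ∷ S`, and up to its first vertex there it runs inside `es`, where
    -- `S′` blocks it.
    separates-tail : ∀ {S′} → Separates es A (_∈ x ∷ S) S′ → Separates ((x , y) ∷ es) A B S′
    separates-tail {S′} sep′ c a∈A b∈B avoid with cut c avoid
      where
      cut : ∀ {a b l} → Chain E⟨ (x , y) ∷ es ⟩ a b l → All (_∉ S′) l →
            (∃[ v ] ∃[ m ] Chain E⟨ es ⟩ a v m × v ∈ x ∷ S × All (_∉ S′) m) ⊎
            (Chain E⟨ es ⟩ a b l × All (_∉ S) l)
      cut {a} c avoid with a ∈? (x ∷ S)
      cut [ a ]              (p ∷ _)  | yes a∈ = inj₁ (a , _ , [ a ] , a∈ , p ∷ [])
      cut {a} (_ ∷ _)        (p ∷ _)  | yes a∈ = inj₁ (a , _ , [ a ] , a∈ , p ∷ [])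
      cut [ a ]              _        | no a∉  = inj₂ ([ a ] , a∉ ∘ there ∷ [])
      cut (here refl ∷ _)    _        | no a∉  = contradiction (here refl) a∉
      cut (there e ∷ c)      (p ∷ ps) | no a∉ with cut c ps
      ... | inj₁ (v , m , d , v∈ , qs) = inj₁ (v , _ , e ∷ d , v∈ , p ∷ qs)
      ... | inj₂ (d , qs)              = inj₂ (e ∷ d , a∉ ∘ there ∷ qs)
    ... | inj₁ (_ , _ , d , v∈ , qs) = sep′ d a∈A v∈ qs
    ... | inj₂ (d , qs)              = sep d a∈A b∈B qs

    -- Mirror image: from its last vertex in `y ∷ S` on, the chain runs inside `es`.
    separates-head : ∀ {S′} → Separates es (_∈ y ∷ S) B S′ → Separates ((x , y) ∷ es) A B S′
    separates-head {S′} sep′ c a∈A b∈B avoid with cut c avoid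
      where
      cut : ∀ {a b l} → Chain E⟨ (x , y) ∷ es ⟩ a b l → All (_∉ S′) l →
            (∃[ v ] ∃[ m ] Chain E⟨ es ⟩ v b m × v ∈ y ∷ S × All (_∉ S′) m) ⊎
            (Chain E⟨ es ⟩ a b l × All (_∉ S) l × a ≢ y)
      cut [ a ] ps with a ∈? (y ∷ S)
      ... | yes a∈ = inj₁ (a , _ , [ a ] , a∈ , ps)
      ... | no a∉  = inj₂ ([ a ] , a∉ ∘ there ∷ [] , a∉ ∘ here)
      cut {a} (e ∷ c) (p ∷ ps) with cut c ps
      ... | inj₁ r = inj₁ r
      -- The conjunct `a ≢ y` excludes the new arc, which would enter the tail at `y`.
      cut     (here refl ∷ c) _        | inj₂ (_ , _ , ≢y) = contradiction refl ≢y
      cut {a} (there e ∷ c)   (p ∷ ps) | inj₂ (d , qs , _) with a ∈? (y ∷ S)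
      ... | yes a∈ = inj₁ (a , _ , e ∷ d , a∈ , p ∷ ps)
      ... | no a∉  = inj₂ (e ∷ d , a∉ ∘ there ∷ qs , a∉ ∘ here)
    ... | inj₁ (_ , _ , d , v∈ , qs) = sep′ d v∈ b∈B qs
    ... | inj₂ (d , qs , _)          = sep d a∈A b∈B qs

    -- The head `p` ends at `x` and the head `q` starts at `y`, so the new arc joins them; the other
    -- links meet pairwise in the vertices of `S` and are glued there.
    assemble : ∀ (p : Link E⟨ es ⟩ A (_∈ x ∷ S)) ps (q : Link E⟨ es ⟩ (_∈ y ∷ S) B) qs →
               Unique (flat (p ∷ ps)) → Unique (flat (q ∷ qs)) →
               x ∷ S ≡ map last (p ∷ ps) → y ∷ S ≡ map first (q ∷ qs) →
               Linkage ((x , y) ∷ es) A B (length (p ∷ ps))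
    assemble p ps q qs ups uqs xS≡ yS≡
      with glueAll ps qs (≡-trans (sym (∷-injectiveʳ xS≡)) (∷-injectiveʳ yS≡))
    ... | rs , rs↭ , len = joined ∷ map (weaken there) rs , unique , ≤-reflexive (cong suc length≡)
      where
      length≡ : length ps ≡ length (map (weaken there) rs)
      length≡ = ≡-trans (sym len) (sym (length-map (weaken there) rs))

      joined : Link E⟨ (x , y) ∷ es ⟩ A B
      joined = link (join (chain-map there (chain p))
                          (here (cong₂ _,_ (sym (∷-injectiveˡ xS≡)) (sym (∷-injectiveˡ yS≡))))
                          (chain-map there (chain q)))
                    (first∈ p) (last∈ q)

      new : List (Fin n)
      new = verts q ++ rests qs

      perm : flat (p ∷ ps) ++ new ↭ flat (joined ∷ map (weaken there) rs)
      perm = trans (interchange (verts p) (flat ps) (verts q) (rests qs))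
        (++⁺ˡ (verts p ++ verts q) (trans (↭-sym rs↭) (↭-reflexive (sym (flat-weaken there rs)))))

      S++new : flat (q ∷ qs) ↭ S ++ new
      S++new = trans (++⁺ˡ (verts q) (flat↭firsts++rests qs))
        (trans (shifts (verts q) (map first qs))
               (↭-reflexive (cong (_++ new) (sym (∷-injectiveʳ yS≡)))))

      unique-S++new : Unique S × Unique new × Disjoint S new
      unique-S++new = Unique-++⁻ S (Unique-resp-↭ S++new uqs)

      front∉S : ∀ {p′} → p′ ∈ p ∷ ps → All (_∉ S) (front (chain p′))
      front∉S p′∈ = All.tabulate λ {w} w∈ w∈S → lasts#fronts
        (subst (w ∈_) xS≡ (there w∈S) , ∈-concatMap⁺′ (front ∘ chain) p′∈ w∈)
        where
        lasts#fronts : Disjoint (map last (p ∷ ps)) (fronts (p ∷ ps))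
        lasts#fronts = proj₂ (proj₂ (Unique-++⁻ (map last (p ∷ ps))
          (Unique-resp-↭ (flat↭lasts++fronts (p ∷ ps)) ups)))

      rest∉S : ∀ {q′} → q′ ∈ q ∷ qs → All (_∉ S) (rest (chain q′))
      rest∉S q′∈ = All.tabulate λ {w} w∈ w∈S → firsts#rests
        (subst (w ∈_) yS≡ (there w∈S) , ∈-concatMap⁺′ (rest ∘ chain) q′∈ w∈)
        where
        firsts#rests : Disjoint (map first (q ∷ qs)) (rests (q ∷ qs))
        firsts#rests = proj₂ (proj₂ (Unique-++⁻ (map first (q ∷ qs))
          (Unique-resp-↭ (flat↭firsts++rests (q ∷ qs)) uqs)))

      -- A common vertex outside S would give an A–B chain in es avoiding S.
      disjoint : Disjoint (flat (p ∷ ps)) new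
      disjoint {w} (w∈ps , w∈new)
        with ∈-flat⁻ (p ∷ ps) w∈ps
           | ∈-flat⁻ (q ∷ qs) (∈-resp-↭ (↭-sym S++new) (∈-++⁺ʳ S w∈new))
      ... | p′ , p′∈ , w∈p′ | q′ , q′∈ , w∈q′
        with prefixAvoiding (chain p′) (front∉S p′∈) w∈p′ w∉S
           | suffixAvoiding (chain q′) (rest∉S q′∈) w∈q′ w∉S
        where
        w∉S : w ∉ S
        w∉S w∈S = proj₂ (proj₂ unique-S++new) (w∈S , w∈new)
      ... | _ , c , c∉S | _ , d , d∉S =
        sep (glue c d) (first∈ p′) (last∈ q′) (All.++⁺ c∉S (All-rest d d∉S))

      unique : Unique (flat (joined ∷ map (weaken there) rs))
      unique = Unique-resp-↭ perm (Unique.++⁺ ups (proj₁ (proj₂ unique-S++new)) disjoint)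

    -- Pigeonhole: disjoint links have distinct ends, and at least `k` of these lie in `x ∷ S`, so
    -- with `length S < k` they exhaust it; likewise the starts and `y ∷ S`. Reordering then aligns
    -- the two families.
    combine : ∀ {k} → length S < k → Linkage es A (_∈ x ∷ S) k → Linkage es (_∈ y ∷ S) B k →
              Linkage ((x , y) ∷ es) A B k
    combine {k} S<k (ps , ups , k≤ps) (qs , uqs , k≤qs)
      with ↭-map-inv last (unique-⊆-length⇒↭ unique-lasts lasts⊆ (enough last ps k≤ps))
         | ↭-map-inv first (unique-⊆-length⇒↭ unique-firsts firsts⊆ (enough first qs k≤qs))
      where
      unique-lasts : Unique (map last ps)
      unique-lasts = proj₁ (Unique-++⁻ _ (Unique-resp-↭ (flat↭lasts++fronts ps) ups))
      unique-firsts : Unique (map first qs)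
      unique-firsts = proj₁ (Unique-++⁻ _ (Unique-resp-↭ (flat↭firsts++rests qs) uqs))
      lasts⊆ : ∀ {z} → z ∈ map last ps → z ∈ x ∷ S
      lasts⊆ z∈ with ∈-map⁻ last z∈
      ... | p , _ , refl = last∈ p
      firsts⊆ : ∀ {z} → z ∈ map first qs → z ∈ y ∷ S
      firsts⊆ z∈ with ∈-map⁻ first z∈
      ... | q , _ , refl = first∈ q
      enough : ∀ {L : Set} (f : L → Fin n) (ls : List L) → k ≤ length ls →
               suc (length S) ≤ length (map f ls)
      enough f ls k≤ = ≤-trans S<k (≤-trans k≤ (≤-reflexive (sym (length-map f ls))))
    ... | p ∷ ps₁ , xS≡ , ps↭ | q ∷ qs₁ , yS≡ , qs↭
      with assemble p ps₁ q qs₁ (Unique-resp-↭ (flat-↭ ps↭) ups) (Unique-resp-↭ (flat-↭ qs↭) uqs) xS≡ yS≡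
    ... | rs , urs , len = rs , urs , ≤-trans k≤ps (≤-trans (≤-reflexive (↭-length ps↭)) len)

  module _ {A B : Pred (Fin n) 0ℓ} (A? : Decidable A) (B? : Decidable B) where

    common : List (Fin n)
    common = filter (λ v → A? v ×-dec B? v) (allFin n)

    singletons : ∀ vs → All (λ v → A v × B v) vs →
                 Σ[ ps ∈ List (Link E⟨ [] ⟩ A B) ] flat ps ≡ vs × length ps ≡ length vs
    singletons []       []             = [] , refl , refl
    singletons (v ∷ vs) ((a , b) ∷ ab) with singletons vs ab
    ... | ps , flat≡ , len = link [ v ] a b ∷ ps , cong (v ∷_) flat≡ , cong suc len

    -- Without arcs every chain is a single vertex, so `common` supplies either the linkage or the
    -- separator.
    menger-arcless : ∀ k → Linkage [] A B k ⊎ ∃[ S ] length S < k × Separates [] A B S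
    menger-arcless k with ≤-<-connex k (length common)
    ... | inj₂ <k = inj₂ (common , <k , λ where
      [ a ] a∈ b∈ (a∉ ∷ _) → a∉ (∈-filter⁺ (λ v → A? v ×-dec B? v) (∈-allFin a) (a∈ , b∈)))
    ... | inj₁ k≤ with singletons common (All.all-filter (λ v → A? v ×-dec B? v) (allFin n))
    ...   | ps , flat≡ , len =
      inj₁ (ps
           , subst Unique (sym flat≡) (Unique.filter⁺ (λ v → A? v ×-dec B? v) (Unique.allFin⁺ n))
           , ≤-trans k≤ (≤-reflexive (sym len)))

  -- Induction on the arcs: if S separates once the arc (x , y) is dropped, then A is linked
  -- to x ∷ S and y ∷ S is linked to B, and the two linkages meet only in S.
  menger : ∀ es {A B} → Decidable A → Decidable B → ∀ k →
           Linkage es A B k ⊎ ∃[ S ] length S < k × Separates es A B S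
  menger []             A? B? k = menger-arcless A? B? k
  menger ((x , y) ∷ es) A? B? k with menger es A? B? k
  ... | inj₁ (ps , u , k≤) = inj₁ (map (weaken there) ps , subst Unique (sym (flat-weaken there ps)) u
                                  , ≤-trans k≤ (≤-reflexive (sym (length-map (weaken there) ps))))
  ... | inj₂ (S , S<k , sep) with menger es A? (_∈? (x ∷ S)) k | menger es (_∈? (y ∷ S)) B? k
  ...   | inj₂ (S′ , S′<k , sep′) | _                       = inj₂ (S′ , S′<k , separates-tail sep sep′)
  ...   | inj₁ _                  | inj₂ (S′ , S′<k , sep′) = inj₂ (S′ , S′<k , separates-head sep sep′)
  ...   | inj₁ ps                 | inj₁ qs                 = inj₁ (combine sep S<k ps qs)

-- Cutting chains and counting subsets.

module _ {V : Set} {R : Rel V 0ℓ} where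

  -- The cut falls just before the first vertex after `x` found to satisfy `G`. The vertices before
  -- it satisfy `F`, and `¬ F y` guarantees that the search succeeds.
  cut-chain : ∀ {F G : Pred V 0ℓ} {x y l} → Chain R x y l → F x → ¬ F y → (∀ {w} → w ∈ l → G w ⊎ F w) →
              ∃[ b ] ∃[ c ] ∃[ l₁ ] ∃[ l₂ ]
                Chain R x b l₁ × Chain R c y l₂ × l ≡ l₁ ++ l₂ × F b × G c
  cut-chain [ x ]         Fx ¬Fy f = contradiction Fx ¬Fy
  cut-chain (_∷_ {x} e c) Fx ¬Fy f with f (there (first∈verts c))
  ... | inj₁ Gc = x , _ , _ , _ , [ x ] , c , refl , Fx , Gc
  ... | inj₂ Fc with cut-chain c Fc ¬Fy (f ∘ there)
  ...   | b , c′ , _ , _ , d , d′ , refl , Fb , Gc′ = b , c′ , _ , _ , e ∷ d , d′ , refl , Fb , Gc′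

∣p∪q∣≤∣p∣+∣q∣ : ∀ {n} (p q : Subset n) → ∣ p ∪ q ∣ ≤ ∣ p ∣ + ∣ q ∣
∣p∪q∣≤∣p∣+∣q∣ []            []            = z≤n
∣p∪q∣≤∣p∣+∣q∣ (inside  ∷ p) (inside  ∷ q) =
  s≤s (≤-trans (∣p∪q∣≤∣p∣+∣q∣ p q) (+-monoʳ-≤ ∣ p ∣ (m≤n+m ∣ q ∣ 1)))
∣p∪q∣≤∣p∣+∣q∣ (inside  ∷ p) (outside ∷ q) = s≤s (∣p∪q∣≤∣p∣+∣q∣ p q)
∣p∪q∣≤∣p∣+∣q∣ (outside ∷ p) (inside  ∷ q) =
  ≤-trans (s≤s (∣p∪q∣≤∣p∣+∣q∣ p q)) (≤-reflexive (sym (+-suc ∣ p ∣ ∣ q ∣)))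
∣p∪q∣≤∣p∣+∣q∣ (outside ∷ p) (outside ∷ q) = ∣p∪q∣≤∣p∣+∣q∣ p q

module _ {n : ℕ} where

  subset : List (Fin n) → Subset n
  subset = ⋃ ∘ map ⁅_⁆

  ∈-subset⁺ : ∀ {v vs} → v ∈ vs → v Subset.∈ subset vs
  ∈-subset⁺ (here refl) = Subset.x∈p∪q⁺ (inj₁ (Subset.x∈⁅x⁆ _))
  ∈-subset⁺ (there v∈)  = Subset.x∈p∪q⁺ (inj₂ (∈-subset⁺ v∈))

  ∈-subset⁻ : ∀ {v} vs → v Subset.∈ subset vs → v ∈ vs
  ∈-subset⁻ []       v∈ = contradiction v∈ Subset.∉⊥
  ∈-subset⁻ (u ∷ vs) v∈ with Subset.x∈p∪q⁻ ⁅ u ⁆ (subset vs) v∈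
  ... | inj₁ v∈u  = here (Subset.x∈⁅y⁆⇒x≡y u v∈u)
  ... | inj₂ v∈vs = there (∈-subset⁻ vs v∈vs)

  ∣subset∣≤length : ∀ vs → ∣ subset vs ∣ ≤ length vs
  ∣subset∣≤length []       = ≤-reflexive (Subset.∣⊥∣≡0 n)
  ∣subset∣≤length (v ∷ vs) = ≤-trans (∣p∪q∣≤∣p∣+∣q∣ ⁅ v ⁆ (subset vs))
    (+-mono-≤ (≤-reflexive (Subset.∣⁅x⁆∣≡1 v)) (∣subset∣≤length vs))

-- Inserting into and merging chains of a tournament.

module Tournament {n : ℕ} (T : Digraph n) (tournament : IsTournament T) where

  open Digraph T
  open import Algebra.Solver.CommutativeMonoid (++-commutativeMonoid {A = Fin n}) using (solve; _⊕_; _⊜_)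

  asym : ∀ {x y} → Arc x y → ¬ Arc y x
  asym {x} {y} xy yx with tournament x y (λ { refl → loopless x xy })
  ... | inj₁ (_ , ¬yx) = ¬yx yx
  ... | inj₂ (¬xy , _) = ¬xy xy

  total : ∀ {x y} → x ≢ y → Arc x y ⊎ Arc y x
  total x≢y with tournament _ _ x≢y
  ... | inj₁ (xy , _) = inj₁ xy
  ... | inj₂ (_ , yx) = inj₂ yx

  Inserted : Fin n → Fin n → Fin n → List (Fin n) → Set
  Inserted u x y l = ∃[ m ] Chain Arc x y m × m ↭ u ∷ l

  -- The form in which failed insertion is used: an arc between `u` and any vertex of the chain can
  -- be moved to an end of the chain, so the chain may be contracted.
  record Uninsertable (u x y : Fin n) (l : List (Fin n)) : Set where
    field
      from-last : ∀ {p} → p ∈ l → Arc p u → Arc y u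
      to-first  : ∀ {p} → p ∈ l → Arc u p → Arc u x

  open Uninsertable

  insert-after : ∀ {u x y l} → Chain Arc x y l → u ∉ l → Arc x u →
                 Inserted u x y l ⊎ All (λ p → Arc p u) l
  insert-after [ x ]         u∉ xu = inj₂ (xu ∷ [])
  insert-after (_∷_ {x} e c) u∉ xu with total (λ { refl → u∉ (there (first∈verts c)) })
  ... | inj₁ uy = inj₁ (_ , xu ∷ uy ∷ c , swap x _ refl)
  ... | inj₂ yu with insert-after c (u∉ ∘ there) yu
  ...   | inj₁ (_ , d , m↭) = inj₁ (_ , e ∷ d , trans (prep x m↭) (swap x _ refl))
  ...   | inj₂ lu           = inj₂ (xu ∷ lu)

  -- Leading vertices dominated by `u` are skipped, and `to-first` is then immediate. From the first
  -- vertex with an arc to `u` on, either the direction changes, which gives a place for `u`, or all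
  -- arcs go to `u`. The ends stay fixed, so the chain is entered and left as before.
  insert : ∀ {u x y l} → Chain Arc x y l → u ∉ l → Inserted u x y l ⊎ Uninsertable u x y l
  insert [ x ] u∉ = inj₂ record { from-last = λ { (here refl) → id } ; to-first = λ { (here refl) → id } }
  insert {u} (_∷_ {x} e c) u∉ with arc? x u
  ... | yes xu with insert-after (e ∷ c) u∉ xu
  ...   | inj₁ ins = inj₁ ins
  ...   | inj₂ lu  = inj₂ record
    { from-last = λ _ _ → All.lookup lu (last∈verts (e ∷ c))
    ; to-first  = λ p∈ up → contradiction up (asym (All.lookup lu p∈)) }
  insert {u} (_∷_ {x} e c) u∉ | no ¬xu with insert c (u∉ ∘ there)
  ... | inj₁ (_ , d , m↭) = inj₁ (_ , e ∷ d , trans (prep x m↭) (swap x u refl))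
  ... | inj₂ un = inj₂ record
    { from-last = λ { (here refl) xu → contradiction xu ¬xu ; (there p∈) → from-last un p∈ }
    ; to-first  = λ _ _ → ux }
    where
    ux : Arc u x
    ux with total {u} {x} (λ { refl → u∉ (here refl) })
    ... | inj₁ ux = ux
    ... | inj₂ xu = contradiction xu ¬xu

  -- As in merge sort, the arc between the two heads decides. The chosen head has an arc both to its
  -- own successor and to the other head, one of which comes next. The ends of the result are given
  -- ends, so arcs at `s` and `t` survive.
  merge-chains : ∀ {x y x′ y′ l m} → Chain Arc x y l → Chain Arc x′ y′ m → Disjoint l m →
                 ∃[ z ] ∃[ z′ ] ∃[ k ] Chain Arc z z′ k × (z ≡ x ⊎ z ≡ x′) × (z′ ≡ y ⊎ z′ ≡ y′) × k ↭ l ++ m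
  merge-chains c d l#m with total (λ x≡x′ → l#m (first∈verts c , subst (_∈ _) (sym x≡x′) (first∈verts d)))
  merge-chains [ x ]         d l#m | inj₁ xx′ =
    x , _ , _ , xx′ ∷ d , inj₁ refl , inj₂ refl , refl
  merge-chains (_∷_ {x} e c) d l#m | inj₁ xx′ with merge-chains c d (λ (p , q) → l#m (there p , q))
  ... | _ , z′ , _ , b , inj₁ refl , last≡ , k↭ = x , z′ , _ , e ∷ b   , inj₁ refl , last≡ , prep x k↭
  ... | _ , z′ , _ , b , inj₂ refl , last≡ , k↭ = x , z′ , _ , xx′ ∷ b , inj₁ refl , last≡ , prep x k↭
  merge-chains {l = l} c [ x′ ]         l#m | inj₂ x′x =
    x′ , _ , _ , x′x ∷ c , inj₂ refl , inj₁ refl , ↭-sym (trans (shift x′ l []) (prep x′ (↭-reflexive (++-identityʳ l))))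
  merge-chains {l = l} c (_∷_ {x′} e d) l#m | inj₂ x′x with merge-chains c d (λ (p , q) → l#m (p , there q))
  ... | _ , z′ , _ , b , inj₁ refl , last≡ , k↭ = x′ , z′ , _ , x′x ∷ b , inj₂ refl , last≡ , trans (prep x′ k↭) (↭-sym (shift x′ l _))
  ... | _ , z′ , _ , b , inj₂ refl , last≡ , k↭ = x′ , z′ , _ , e ∷ b   , inj₂ refl , last≡ , trans (prep x′ k↭) (↭-sym (shift x′ l _))

  -- Hamiltonian cycles by insertion.

  -- Camion's theorem for a strong semicomplete digraph on W together with an extra
  -- vertex z (represented by `nothing`), where I w and O w are the arcs z → w and w → z.
  module Camion {I O : Pred (Fin n) 0ℓ} (I? : Decidable I) (O? : Decidable O) where

    _⟶_ : Maybe (Fin n) → Fin n → Set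
    nothing ⟶ v = I v
    just u  ⟶ v = Arc u v

    _⟶?_ : ∀ p v → Dec (p ⟶ v)
    nothing ⟶? v = I? v
    just u  ⟶? v = arc? u v

    Closes : Maybe (Fin n) → Set
    Closes nothing  = ⊤
    Closes (just u) = O u

    -- `Tail nothing l` is a cycle through z and `l`, cut open at z; for empty `l` it is the trivial
    -- cycle on z, from which the growth starts.
    data Tail : Maybe (Fin n) → List (Fin n) → Set where
      close : ∀ {p} → Closes p → Tail p []
      _∷_   : ∀ {p v l} → p ⟶ v → Tail (just v) l → Tail p (v ∷ l)

    tail⇒chain : ∀ {p v l} → Tail p (v ∷ l) → ∃[ y ] Chain Arc v y (v ∷ l) × p ⟶ v × O y
    tail⇒chain (e ∷ close o)      = _ , [ _ ] , e , o
    tail⇒chain (e ∷ t@(_ ∷ _)) with tail⇒chain t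
    ... | y , c , f , o = y , f ∷ c , e , o

    InsertedTail : Maybe (Fin n) → Fin n → List (Fin n) → Set
    InsertedTail p u l = ∃[ m ] Tail p m × m ↭ u ∷ l

    insert-tail-after : ∀ {p u l} → Tail p l → u ∉ l → p ⟶ u →
                        InsertedTail p u l ⊎ (¬ O u × All (λ q → Arc q u) l)
    insert-tail-after {u = u} (close _) u∉ pu with O? u
    ... | yes o = inj₁ (_ , pu ∷ close o , refl)
    ... | no ¬o = inj₂ (¬o , [])
    insert-tail-after (e ∷ t) u∉ pu with total (λ { refl → u∉ (here refl) })
    ... | inj₁ uq = inj₁ (_ , pu ∷ uq ∷ t , refl)
    ... | inj₂ qu with insert-tail-after t (u∉ ∘ there) qu
    ...   | inj₁ (_ , t′ , m↭) = inj₁ (_ , e ∷ t′ , trans (prep _ m↭) (swap _ _ refl))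
    ...   | inj₂ (¬o , lu)     = inj₂ (¬o , qu ∷ lu)

    -- Since `O u` holds, `insert-tail-after` succeeds as soon as some vertex has an arc to `u`;
    -- failure therefore means that none has.
    insert-tail-before : ∀ {p u l} → Tail p l → u ∉ l → O u →
                         InsertedTail p u l ⊎ (¬ p ⟶ u × All (Arc u) l)
    insert-tail-before {p} {u} t u∉ o with p ⟶? u
    ... | yes pu with insert-tail-after t u∉ pu
    ...   | inj₁ ins      = inj₁ ins
    ...   | inj₂ (¬o , _) = contradiction o ¬o
    insert-tail-before (close _) u∉ o | no ¬pu = inj₂ (¬pu , [])
    insert-tail-before (e ∷ t)   u∉ o | no ¬pu with insert-tail-before t (u∉ ∘ there) o
    ... | inj₁ (_ , t′ , m↭) = inj₁ (_ , e ∷ t′ , trans (prep _ m↭) (swap _ _ refl))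
    ... | inj₂ (¬qu , ul) with total (λ { refl → u∉ (here refl) })
    ...   | inj₁ uq = inj₂ (¬pu , uq ∷ ul)
    ...   | inj₂ qu = contradiction qu ¬qu

    data To-z (W : List (Fin n)) : Fin n → Set where
      here : ∀ {u} → O u → To-z W u
      step : ∀ {u v} → Arc u v → v ∈ W → To-z W v → To-z W u

    data From-z (W : List (Fin n)) : Fin n → Set where
      here : ∀ {u} → I u → From-z W u
      step : ∀ {u v} → v ∈ W → From-z W v → Arc v u → From-z W u

    module _ {W : List (Fin n)} (unique : Unique W)
             (adjacent : ∀ {u} → u ∈ W → I u ⊎ O u)
             (to-z : ∀ {u} → u ∈ W → To-z W u) (from-z : ∀ {u} → u ∈ W → From-z W u) where

      module _ {l U : List (Fin n)} (tail : Tail nothing l) (l++U↭W : l ++ U ↭ W) where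

        Dominated Dominating : Fin n → Set
        Dominated  u = I u × ¬ O u × All (λ q → Arc q u) l
        Dominating u = O u × ¬ I u × All (Arc u) l

        l#U : Disjoint l U
        l#U = proj₂ (proj₂ (Unique-++⁻ l (Unique-resp-↭ (↭-sym l++U↭W) unique)))

        U⊆W : ∀ {u} → u ∈ U → u ∈ W
        U⊆W u∈ = ∈-resp-↭ l++U↭W (∈-++⁺ʳ l u∈)

        -- A vertex that fits nowhere sees no change of direction around the cycle, so all arcs
        -- between it and the cycle, z included, point the same way.
        classify : ∀ {u} → u ∈ U → InsertedTail nothing u l ⊎ (Dominated u ⊎ Dominating u)
        classify {u} u∈ with I? u
        ... | yes i with insert-tail-after tail (λ u∈l → l#U (u∈l , u∈)) i
        ...   | inj₁ ins       = inj₁ ins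
        ...   | inj₂ (¬o , lu) = inj₂ (inj₁ (i , ¬o , lu))
        classify {u} u∈ | no ¬i with adjacent (U⊆W u∈)
        ... | inj₁ i = contradiction i ¬i
        ... | inj₂ o with insert-tail-before tail (λ u∈l → l#U (u∈l , u∈)) o
        ...   | inj₁ ins      = inj₁ ins
        ...   | inj₂ (_ , ul) = inj₂ (inj₂ (o , ¬i , ul))

        Pair : Set
        Pair = ∃[ x ] ∃[ y ] x ∈ U × y ∈ U × Dominated x × Dominating y × Arc x y

        module _ (classes : All (λ u → Dominated u ⊎ Dominating u) U) where

          -- A dominated vertex has no arc to z or into the cycle, so its walk to z must at some
          -- step pass from a dominated to a dominating vertex of `U`.
          pair-from-dominated : ∀ {u} → u ∈ U → Dominated u → To-z W u → Pair
          pair-from-dominated u∈ (_ , ¬o , _) (here o) = contradiction o ¬o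
          pair-from-dominated u∈ dom@(_ , _ , lu) (step {u} {v} uv v∈W r)
            with ∈-++⁻ l (∈-resp-↭ (↭-sym l++U↭W) v∈W)
          ... | inj₁ v∈l = contradiction uv (asym (All.lookup lu v∈l))
          ... | inj₂ v∈U with All.lookup classes v∈U
          ...   | inj₁ dom′ = pair-from-dominated v∈U dom′ r
          ...   | inj₂ dom′ = u , v , u∈ , v∈U , dom , dom′ , uv

          pair-from-dominating : ∀ {u} → u ∈ U → Dominating u → From-z W u → Pair
          pair-from-dominating u∈ (_ , ¬i , _) (here i) = contradiction i ¬i
          pair-from-dominating u∈ dom@(_ , _ , ul) (step {u} {v} v∈W r vu)
            with ∈-++⁻ l (∈-resp-↭ (↭-sym l++U↭W) v∈W)
          ... | inj₁ v∈l = contradiction vu (asym (All.lookup ul v∈l))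
          ... | inj₂ v∈U with All.lookup classes v∈U
          ...   | inj₁ dom′ = v , u , v∈U , u∈ , dom′ , dom , vu
          ...   | inj₂ dom′ = pair-from-dominating v∈U dom′ r

          pair : ∀ {u} → u ∈ U → Pair
          pair u∈ with All.lookup classes u∈
          ... | inj₁ dom = pair-from-dominated  u∈ dom (to-z (U⊆W u∈))
          ... | inj₂ dom = pair-from-dominating u∈ dom (from-z (U⊆W u∈))

      prepend : ∀ {x y l} → Tail nothing l → I x → Arc x y → O y → All (Arc y) l →
                Tail nothing (x ∷ y ∷ l)
      prepend (close _) i xy o _        = i ∷ xy ∷ close o
      prepend (_ ∷ t)   i xy o (yv ∷ _) = i ∷ xy ∷ yv ∷ t

      -- If no single vertex fits, there is an arc from a dominated to a dominating vertex, and both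
      -- go in together right after z. The bound `b` makes the recursion structural.
      grow : ∀ b {l U} → length U ≤ b → Tail nothing l → l ++ U ↭ W →
             ∃[ m ] Tail nothing m × m ↭ W
      grow b {l} {[]} _ t l++U↭ = l , t , trans (↭-reflexive (sym (++-identityʳ l))) l++U↭
      grow (suc b) {l} {U@(_ ∷ _)} len t l++U↭ with split (classify t l++U↭)
      ... | inj₁ (u , U′ , U↭ , m , t′ , m↭) = grow b
        (s≤s⁻¹ (≤-trans (≤-reflexive (sym (↭-length U↭))) len)) t′
        (trans (++⁺ʳ U′ m↭) (trans (↭-sym (shift u l U′)) (trans (++⁺ˡ l (↭-sym U↭)) l++U↭)))
      ... | inj₂ classes with pair t l++U↭ classes (here refl)
      ...   | x , y , x∈ , y∈ , (i , _ , _) , (o , _ , yl) , xy with ∈⇒↭ x∈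
      ...     | U₁ , U↭ with ∈-resp-↭ U↭ y∈
      ...       | here refl = contradiction xy (loopless x)
      ...       | there y∈₁ with ∈⇒↭ y∈₁
      ...         | U₂ , U₁↭ = grow b
        (≤-trans (m≤n+m _ 1) (s≤s⁻¹ (≤-trans (≤-reflexive (sym (↭-length U↭₂))) len)))
        (prepend t i xy o yl)
        (trans (shifts (x ∷ y ∷ []) l) (trans (++⁺ˡ l (↭-sym U↭₂)) l++U↭))
        where
        U↭₂ : U ↭ x ∷ y ∷ U₂
        U↭₂ = trans U↭ (prep x U₁↭)

      hamiltonian : ∃[ m ] Tail nothing m × m ↭ W
      hamiltonian = grow (length W) ≤-refl (close tt) refl

  -- Interiors of (s,t)-paths.

  linked⇒chain : ∀ {u v} l → Linked Arc (u ∷ l ∷ʳ v) → Chain Arc u v (u ∷ l ∷ʳ v)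
  linked⇒chain []      (e ∷ [-]) = e ∷ [ _ ]
  linked⇒chain (_ ∷ l) (e ∷ r)   = e ∷ linked⇒chain l r

  chain⇒linked : ∀ {x y u v l} → Arc u x → Chain Arc x y l → Arc y v → Linked Arc (u ∷ l ∷ʳ v)
  chain⇒linked e [ _ ]   f = e ∷ f ∷ [-]
  chain⇒linked e (g ∷ c) f = e ∷ chain⇒linked g c f

  module Between {s t : Fin n} (s≢t : s ≢ t) where

    Other : Pred (Fin n) 0ℓ
    Other v = v ≢ s × v ≢ t

    other? : Decidable Other
    other? v = ¬? (v ≟ s) ×-dec ¬? (v ≟ t)

    others : List (Fin n)
    others = filter other? (allFin n)

    ∈-others⁺ : ∀ {v} → Other v → v ∈ others
    ∈-others⁺ {v} = ∈-filter⁺ other? (∈-allFin v)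

    ∈-others⁻ : ∀ {v} → v ∈ others → Other v
    ∈-others⁻ = proj₂ ∘ ∈-filter⁻ other? {xs = allFin n}

    unique-others : Unique others
    unique-others = Unique.filter⁺ other? (Unique.allFin⁺ n)

    -- The interior of an (s,t)-path. Chains are nonempty, so the one-arc path is excluded and
    -- disjoint pieces are distinct.
    Piece : Set
    Piece = Link Arc (Arc s) (λ v → Arc v t)

    merge : (p q : Piece) → Disjoint (verts p) (verts q) →
            Σ[ r ∈ Piece ] verts r ↭ verts p ++ verts q
    merge (link c a b) (link d a′ b′) p#q with merge-chains c d p#q
    ... | _ , _ , _ , e , inj₁ refl , inj₁ refl , r↭ = link e a  b  , r↭
    ... | _ , _ , _ , e , inj₁ refl , inj₂ refl , r↭ = link e a  b′ , r↭
    ... | _ , _ , _ , e , inj₂ refl , inj₁ refl , r↭ = link e a′ b  , r↭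
    ... | _ , _ , _ , e , inj₂ refl , inj₂ refl , r↭ = link e a′ b′ , r↭

    -- Each merge lowers the count by one. The target `suc k` is positive, so two pieces are
    -- available as long as `d` is nonzero.
    reduce : ∀ d k (ps : List Piece) → length ps ≡ d + suc k → Unique (flat ps) →
             Σ[ qs ∈ List Piece ] flat qs ↭ flat ps × length qs ≡ suc k
    reduce zero          k ps           len u = ps , refl , len
    reduce (suc zero)    k (p ∷ [])     () u
    reduce (suc (suc d)) k (p ∷ [])     () u
    reduce (suc d)       k (p ∷ q ∷ ps) len u with Unique-++⁻ (verts p) u
    ... | _ , _ , p#qs with merge p q (λ (w∈p , w∈q) → p#qs (w∈p , ∈-++⁺ˡ w∈q))
    ...   | r , r↭ =
      let qs , qs↭ , len′ = reduce d k (r ∷ ps) (suc-injective len) (Unique-resp-↭ (↭-sym flat↭) u)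
      in qs , trans qs↭ flat↭ , len′
      where
      flat↭ : flat (r ∷ ps) ↭ flat (p ∷ q ∷ ps)
      flat↭ = trans (++⁺ʳ (flat ps) r↭) (↭-reflexive (++-assoc (verts p) (verts q) (flat ps)))

    -- Splicing a path of leftover vertices into the pieces.

    -- At most three pieces are fused into one, so at most two are lost; hence the start with
    -- `3 + k` paths.
    Extension : List Piece → List (Fin n) → Set
    Extension ps l = Σ[ qs ∈ List Piece ] flat qs ↭ flat ps ++ l × length ps ≤ 2 + length qs

    extension-resp-↭ : ∀ {ps ps′ l} → ps ↭ ps′ → Extension ps′ l → Extension ps l
    extension-resp-↭ {l = l} ps↭ (qs , qs↭ , len) =
      qs , trans qs↭ (++⁺ʳ l (flat-↭ (↭-sym ps↭))) , ≤-trans (≤-reflexive (↭-length ps↭)) len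

    module _ (ps : List Piece) where

      -- The arcs between a leftover vertex and s, t and the pieces contracted to one vertex.
      Entry Exit : Pred (Fin n) 0ℓ
      Entry w = Arc s w ⊎ Any (λ p → Arc (last p) w) ps
      Exit  w = Arc w t ⊎ Any (λ p → Arc w (first p)) ps

      entry? : Decidable Entry
      entry? w = arc? s w ⊎-dec any? (λ p → arc? (last p) w) ps

      exit? : Decidable Exit
      exit? w = arc? w t ⊎-dec any? (λ p → arc? w (first p)) ps

    prefix-piece : ∀ {x y l} → Chain Arc x y l → Arc s x → ∀ p ps → Arc y (first p) → Extension (p ∷ ps) l
    prefix-piece {l = l} c sx p ps yp =
      link (join c yp (chain p)) sx (last∈ p) ∷ ps
      , solve 3 (λ l p ps → (l ⊕ p) ⊕ ps ⊜ (p ⊕ ps) ⊕ l) refl l (verts p) (flat ps)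
      , m≤n+m _ 2

    suffix-piece : ∀ {x y l} → Chain Arc x y l → Arc y t → ∀ p ps → Arc (last p) x → Extension (p ∷ ps) l
    suffix-piece {l = l} c yt p ps px =
      link (join (chain p) px c) (first∈ p) yt ∷ ps
      , solve 3 (λ l p ps → (p ⊕ l) ⊕ ps ⊜ (p ⊕ ps) ⊕ l) refl l (verts p) (flat ps)
      , m≤n+m _ 2

    join-pieces : ∀ {x y l} → Chain Arc x y l → ∀ p q ps → Arc (last p) x → Arc y (first q) →
                  Extension (p ∷ q ∷ ps) l
    join-pieces {l = l} c p q ps px yq =
      link (join (join (chain p) px c) yq (chain q)) (first∈ p) (last∈ q) ∷ ps
      , solve 4 (λ l p q ps → ((p ⊕ l) ⊕ q) ⊕ ps ⊜ (p ⊕ q ⊕ ps) ⊕ l) refl l (verts p) (verts q) (flat ps)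
      , m≤n+m _ 1

    join-three-pieces : ∀ {x b c y l m} → Chain Arc x b l → Chain Arc c y m → ∀ p q r ps →
                        Arc (last q) c → Arc y (first p) → Arc (last p) x → Arc b (first r) →
                        Extension (p ∷ q ∷ r ∷ ps) (l ++ m)
    join-three-pieces {l = l} {m} cl cm p q r ps qc yp px br =
      link (join (join (join (join (chain q) qc cm) yp (chain p)) px cl) br (chain r)) (first∈ q) (last∈ r) ∷ ps
      , solve 6 (λ l m p q r ps → ((((q ⊕ m) ⊕ p) ⊕ l) ⊕ r) ⊕ ps ⊜ (p ⊕ q ⊕ r ⊕ ps) ⊕ (l ⊕ m)) refl
          l m (verts p) (verts q) (verts r) (flat ps)
      -- Three pieces become one, so the bound in `Extension` is attained.
      , ≤-refl

    Dichotomy : List Piece → List (Fin n) → Set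
    Dichotomy ps l = ∀ {w p} → w ∈ l → p ∈ ps → Arc (last p) w ⊎ Arc w (first p)

    -- x and y are attached to the same piece p only. Following the chain from x, take the
    -- first vertex c entered from the end of some other piece q; its predecessor b leads
    -- into every other piece r, so the chain can be laid out as  q [c … y] p [x … b] r.
    extend-cyclic : ∀ {x y l} → Chain Arc x y l → ∀ p ps → 2 ≤ length ps → Dichotomy ps l →
                    Arc (last p) x → Arc y (first p) →
                    All (λ q → Arc x (first q)) ps → All (λ q → ¬ Arc y (first q)) ps →
                    Extension (p ∷ ps) l
    extend-cyclic c p ps@(_ ∷ _) 2≤ dich px yp x→ ¬y→
      -- The cut exists because `x` has arcs to the first vertices of all other pieces, `y` to none
      -- of them, and `ps` is nonempty.
      with cut-chain c x→ (λ y→ → All.head ¬y→ (All.head y→)) (λ w∈ → split (dich w∈))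
    ... | _ , _ , _ , _ , c₁ , c₂ , refl , b→ , q , qs , ps↭ , qc with qs | ps↭
    ...   | []     | ps↭₁ = contradiction (subst (2 ≤_) (↭-length ps↭₁) 2≤) λ { (s≤s ()) }
    ...   | r ∷ rs | ps↭₁ = extension-resp-↭ (prep p ps↭₁)
      (join-three-pieces c₁ c₂ p q r rs qc yp px (All.head (All.tail (All-resp-↭ ps↭₁ b→))))

    -- If `x` is entered from `s` or `y` leads to `t`, at most one piece is extended. Otherwise some
    -- `p` enters `x`. If `y` leads to another piece, the two are joined; if not, `y` leads to `p`,
    -- and either another piece enters `x` or, by the dichotomy, `x` leads to all others: the cyclic
    -- case.
    extend : ∀ {x y l} → Chain Arc x y l → ∀ ps → 3 ≤ length ps → Dichotomy ps l →
             Entry ps x → Exit ps y → Extension ps l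
    extend {l = l} c ps _ _ (inj₁ sx) (inj₁ yt) =
      link c sx yt ∷ ps , ++-comm l (flat ps) , m≤n+m _ 3
    extend c ps _ _ (inj₁ sx) (inj₂ any) with find any
    ... | p , p∈ , yp with ∈⇒↭ p∈
    ...   | qs , ps↭ = extension-resp-↭ ps↭ (prefix-piece c sx p qs yp)
    extend c ps _ _ (inj₂ any) (inj₁ yt) with find any
    ... | p , p∈ , px with ∈⇒↭ p∈
    ...   | qs , ps↭ = extension-resp-↭ ps↭ (suffix-piece c yt p qs px)
    extend {x} {y} c ps 3≤ dich (inj₂ any) (inj₂ any′) with find any
    ... | p , p∈ , px with ∈⇒↭ p∈
    ...   | qs , ps↭ with split {P = λ q → Arc y (first q)} {Q = λ q → ¬ Arc y (first q)} {xs = qs} (λ _ → toSum (arc? y _))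
    ...     | inj₁ (q , rs , qs↭ , yq) = extension-resp-↭ (trans ps↭ (prep p qs↭)) (join-pieces c p q rs px yq)
    ...     | inj₂ ¬y→ with Any-resp-↭ ps↭ any′
    ...       | there any″ = contradiction any″ (All.All¬⇒¬Any ¬y→)
    ...       | here yp with split {P = λ q → Arc (last q) x} {xs = qs} (λ q∈ → dich (first∈verts c) (∈-resp-↭ (↭-sym ps↭) (there q∈)))
    ...         | inj₁ (q , rs , qs↭ , qx) = extension-resp-↭ (trans ps↭ (trans (prep p qs↭) (swap p q refl))) (join-pieces c q p rs qx yp)
    ...         | inj₂ x→ = extension-resp-↭ ps↭
      (extend-cyclic c p qs (s≤s⁻¹ (subst (3 ≤_) (↭-length ps↭) 3≤))
        (λ w∈ q∈ → dich w∈ (∈-resp-↭ (↭-sym ps↭) (there q∈))) px yp x→ ¬y→)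

    -- Absorbing the leftover vertices.

    module _ (strong : ∀ v → StronglyConnectedWithout T ⁅ v ⁆) where

      module _ {ps : List Piece} {W : List (Fin n)} (ps++W↭ : flat ps ++ W ↭ others)
               (stuck : ∀ {w p} → w ∈ W → p ∈ ps → Uninsertable w (first p) (last p) (verts p)) where

        open Camion (entry? ps) (exit? ps)

        unique-ps++W : Unique (flat ps) × Unique W × Disjoint (flat ps) W
        unique-ps++W = Unique-++⁻ (flat ps) (Unique-resp-↭ (↭-sym ps++W↭) unique-others)

        W⊆others : ∀ {w} → w ∈ W → Other w
        W⊆others w∈ = ∈-others⁻ (∈-resp-↭ ps++W↭ (∈-++⁺ʳ (flat ps) w∈))

        -- An arc from `first p` to `w` can be moved to `last p`, as `w` is uninsertable.
        dichotomy : Dichotomy ps W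
        dichotomy {w} {p} w∈ p∈ with total {first p} {w} (λ { refl →
          proj₂ (proj₂ unique-ps++W) (∈-concatMap⁺′ verts p∈ (first∈verts (chain p)) , w∈) })
        ... | inj₁ pw = inj₁ (from-last (stuck w∈ p∈) (first∈verts (chain p)) pw)
        ... | inj₂ wp = inj₂ wp

        locate : ∀ {v} → Other v → v ∈ flat ps ⊎ v ∈ W
        locate o = ∈-++⁻ (flat ps) (∈-resp-↭ (↭-sym ps++W↭) (∈-others⁺ o))

        -- Arcs into `s` do not count as `Exit`, so the path must avoid `s`. It then leaves `W` for
        -- `t` or for a piece, and `to-first` moves the latter arc to the first vertex of the piece.
        leave : ∀ {w l} → Chain Arc w t l → All (_≢ s) l → w ∈ W → To-z W w
        leave [ _ ]   _        w∈ = contradiction refl (proj₂ (W⊆others w∈))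
        leave (_∷_ {y = v} e c) (_ ∷ a) w∈ with v ≟ t
        ... | yes refl = here (inj₁ e)
        ... | no v≢t with locate (All.lookup a (first∈verts c) , v≢t)
        ...   | inj₂ v∈W = step e v∈W (leave c a v∈W)
        ...   | inj₁ v∈ps with ∈-flat⁻ ps v∈ps
        ...     | p , p∈ , v∈p = here (inj₂ (lose p∈ (to-first (stuck w∈ p∈) v∈p e)))

        -- Dual of `leave`, but read forward from `s`, so the state of the current vertex is carried
        -- along: it is `s`, in a piece, or in `W` with a walk from z already found.
        arrive : ∀ {a w l} → Chain Arc a w l → All (_≢ t) l → w ∈ W →
                 a ≡ s ⊎ a ∈ flat ps ⊎ (a ∈ W × From-z W a) → From-z W w
        arrive [ _ ] _ w∈ (inj₁ refl)             = contradiction refl (proj₁ (W⊆others w∈))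
        arrive [ _ ] _ w∈ (inj₂ (inj₁ w∈ps))      = ⊥-elim (proj₂ (proj₂ unique-ps++W) (w∈ps , w∈))
        arrive [ _ ] _ w∈ (inj₂ (inj₂ (_ , from))) = from
        arrive (_∷_ {y = v} e c) (_ ∷ a) w∈ origin with v ≟ s
        ... | yes v≡s = arrive c a w∈ (inj₁ v≡s)
        ... | no v≢s with locate (v≢s , All.lookup a (first∈verts c))
        ...   | inj₁ v∈ps = arrive c a w∈ (inj₂ (inj₁ v∈ps))
        ...   | inj₂ v∈W  = arrive c a w∈ (inj₂ (inj₂ (v∈W , reached origin)))
          where
          reached : _ → From-z W v
          reached (inj₁ refl)                  = here (inj₁ e)
          reached (inj₂ (inj₂ (a∈W , from)))   = step a∈W from e
          reached (inj₂ (inj₁ a∈ps)) with ∈-flat⁻ ps a∈ps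
          ... | p , p∈ , a∈p = here (inj₂ (lose p∈ (from-last (stuck v∈W p∈) a∈p e)))

        to-z : ∀ {w} → w ∈ W → To-z W w
        to-z {w} w∈ with strong s w t (Subset.x≢y⇒x∉⁅y⁆ (proj₁ (W⊆others w∈)))
                          (Subset.x≢y⇒x∉⁅y⁆ (s≢t ∘ sym)) (proj₂ (W⊆others w∈))
        ... | p , avoid = leave (linked⇒chain (Path.interior p) (Path.linked p))
                                (All.map Subset.x∉⁅y⁆⇒x≢y avoid) w∈

        from-z : ∀ {w} → w ∈ W → From-z W w
        from-z {w} w∈ with strong t s w (Subset.x≢y⇒x∉⁅y⁆ s≢t)
                            (Subset.x≢y⇒x∉⁅y⁆ (proj₂ (W⊆others w∈))) (proj₁ (W⊆others w∈) ∘ sym)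
        ... | p , avoid = arrive (linked⇒chain (Path.interior p) (Path.linked p))
                                 (All.map Subset.x∉⁅y⁆⇒x≢y avoid) w∈ (inj₁ refl)

        adjacent : ∀ {p} → p ∈ ps → ∀ {w} → w ∈ W → Entry ps w ⊎ Exit ps w
        adjacent p∈ w∈ with dichotomy w∈ p∈
        ... | inj₁ pw = inj₁ (inj₂ (lose p∈ pw))
        ... | inj₂ wp = inj₂ (inj₂ (lose p∈ wp))

        -- Removing z from the Hamiltonian cycle leaves a chain through all of `W` with an entry and
        -- an exit. The member `w` excludes the trivial cycle, and `p` makes every leftover vertex
        -- adjacent to z.
        absorb-stuck : ∀ {w p} → w ∈ W → p ∈ ps → 3 ≤ length ps → Extension ps W
        absorb-stuck w∈ p∈ 3≤ with hamiltonian (proj₁ (proj₂ unique-ps++W)) (adjacent p∈) to-z from-z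
        ... | []    , _ , l↭ with ∈-resp-↭ (↭-sym l↭) w∈
        ...   | ()
        absorb-stuck w∈ p∈ 3≤ | _ ∷ _ , tail , l↭ with tail⇒chain tail
        ... | _ , c , entry , exit with extend c ps 3≤ (dichotomy ∘ ∈-resp-↭ l↭) entry exit
        ...   | qs , qs↭ , len = qs , trans qs↭ (++⁺ˡ (flat ps) l↭) , len

      insert-piece : ∀ p {w} → w ∉ verts p →
                     (Σ[ q ∈ Piece ] verts q ↭ w ∷ verts p) ⊎ Uninsertable w (first p) (last p) (verts p)
      insert-piece (link c a b) w∉ with insert c w∉
      ... | inj₁ (_ , d , m↭) = inj₁ (link d a b , m↭)
      ... | inj₂ un           = inj₂ un

      -- Single insertions keep the number of pieces. When none is possible, one extension takes in
      -- all of `W` and ends the process, so the loss of two pieces occurs at most once.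
      absorb : ∀ b ps W → length W ≤ b → flat ps ++ W ↭ others → 3 ≤ length ps →
               Σ[ qs ∈ List Piece ] flat qs ↭ others × length ps ≤ 2 + length qs
      absorb b ps [] _ ps++W↭ _ =
        ps , trans (↭-reflexive (sym (++-identityʳ (flat ps)))) ps++W↭ , m≤n+m _ 2
      absorb (suc b) ps@(_ ∷ _) W@(_ ∷ _) len ps++W↭ 3≤
        with split {Q = λ w → All (λ p → Uninsertable w (first p) (last p) (verts p)) ps} {xs = W}
          (λ {w} w∈ → split {P = λ p → Σ[ q ∈ Piece ] verts q ↭ w ∷ verts p}
            (λ {p} p∈ → insert-piece p λ w∈p →
              proj₂ (proj₂ (Unique-++⁻ (flat ps) (Unique-resp-↭ (↭-sym ps++W↭) unique-others)))
                (∈-concatMap⁺′ verts p∈ w∈p , w∈)))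
      ... | inj₂ stuck with absorb-stuck ps++W↭ (λ w∈ → All.lookup (All.lookup stuck w∈))
                              (here refl) (here refl) 3≤
      ...   | qs , qs↭ , len′ = qs , trans qs↭ ps++W↭ , len′
      absorb (suc b) ps@(_ ∷ _) W@(_ ∷ _) len ps++W↭ 3≤
          | inj₁ (w , W′ , W↭ , p , ps′ , ps↭ , q , q↭)
        with absorb b (q ∷ ps′) W′ (s≤s⁻¹ (≤-trans (≤-reflexive (sym (↭-length W↭))) len))
               (trans perm ps++W↭) (subst (3 ≤_) (↭-length ps↭) 3≤)
        where
        perm : flat (q ∷ ps′) ++ W′ ↭ flat ps ++ W
        perm = trans (++⁺ʳ W′ (++⁺ʳ (flat ps′) q↭))
          (trans (↭-sym (shift w (verts p ++ flat ps′) W′)) (++⁺ (flat-↭ (↭-sym ps↭)) (↭-sym W↭)))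
      ... | qs , qs↭ , len′ = qs , qs↭ , ≤-trans (≤-reflexive (↭-length ps↭)) len′

    -- From pieces to a container.

    pieces-disjoint : ∀ (ps : List Piece) → Unique (flat ps) → ∀ i j → i ≢ j →
                      Disjoint (verts (lookup ps i)) (verts (lookup ps j))
    pieces-disjoint (p ∷ ps) u zero    zero    i≢j _ = i≢j refl
    pieces-disjoint (p ∷ ps) u zero    (suc j) i≢j (w∈i , w∈j) =
      proj₂ (proj₂ (Unique-++⁻ (verts p) u)) (w∈i , ∈-concatMap⁺′ verts (∈-lookup {xs = ps} j) w∈j)
    pieces-disjoint (p ∷ ps) u (suc i) zero    i≢j (w∈i , w∈j) =
      proj₂ (proj₂ (Unique-++⁻ (verts p) u)) (w∈j , ∈-concatMap⁺′ verts (∈-lookup {xs = ps} i) w∈i)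
    pieces-disjoint (p ∷ ps) u (suc i) (suc j) i≢j =
      pieces-disjoint ps (proj₁ (proj₂ (Unique-++⁻ (verts p) u))) i j (i≢j ∘ cong suc)

    piece-unique : ∀ {ps : List Piece} {p} → Unique (flat ps) → p ∈ ps → Unique (verts p)
    piece-unique {p ∷ ps} u (here refl) = proj₁ (Unique-++⁻ (verts p) u)
    piece-unique {p ∷ ps} u (there p∈)  = piece-unique (proj₁ (proj₂ (Unique-++⁻ (verts p) u))) p∈

    toPath : (p : Piece) → Unique (verts p) → All Other (verts p) → Path T s t
    toPath p u other = record
      { interior = verts p
      ; linked   = chain⇒linked (first∈ p) (chain p) (last∈ p)
      ; unique   = All.++⁺ (All.map (λ (≢s , _) → ≢s ∘ sym) other) (s≢t ∷ []) ∷
                   Unique.++⁺ u ([] ∷ []) λ { (w∈ , here refl) → proj₂ (All.lookup other w∈) refl }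
      }

    pieces⇒container : (ps : List Piece) → flat ps ↭ others → 1 ≤ length ps → Container T (length ps) s t
    pieces⇒container ps@(_ ∷ _) ps↭ _ = record
      { paths    = paths
      ; distinct = distinct
      ; disjoint = pieces-disjoint ps unique-ps
      ; spanning = spanning
      }
      where
      unique-ps : Unique (flat ps)
      unique-ps = Unique-resp-↭ (↭-sym ps↭) unique-others

      paths : Fin (length ps) → Path T s t
      paths i = toPath (lookup ps i) (piece-unique unique-ps (∈-lookup {xs = ps} i))
        (All.tabulate λ w∈ → ∈-others⁻ (∈-resp-↭ ps↭ (∈-concatMap⁺′ verts (∈-lookup {xs = ps} i) w∈)))

      distinct : ∀ {i j} → verts (lookup ps i) ≡ verts (lookup ps j) → i ≡ j
      distinct {i} {j} eq with i ≟ j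
      ... | yes i≡j = i≡j
      ... | no i≢j  = ⊥-elim (pieces-disjoint ps unique-ps i j i≢j
        (first∈verts (chain (lookup ps i)) , subst (_ ∈_) eq (first∈verts (chain (lookup ps i)))))

      spanning : ∀ w → ∃[ i ] w ∈ Path.vertices (paths i)
      spanning w with w ≟ s | w ≟ t
      ... | yes refl | _        = zero , here refl
      ... | no _     | yes refl = zero , there (∈-++⁺ʳ (verts (lookup ps zero)) (here refl))
      ... | no w≢s   | no w≢t with ∈-flat⁻ ps (∈-resp-↭ (↭-sym ps↭) (∈-others⁺ (w≢s , w≢t)))
      ...   | p , p∈ , w∈p = Any.index p∈ , there (∈-++⁺ˡ (subst (λ q → w ∈ verts q) (lookup-index p∈) w∈p))

    -- Menger's theorem applied to the tournament.

    inner? : ∀ ((x , y) : Fin n × Fin n) → Dec (Arc x y × Other x × Other y)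
    inner? (x , y) = arc? x y ×-dec other? x ×-dec other? y

    -- The arcs of T - {s, t}. Disjoint links there from `Source` to `Sink` are interiors of
    -- internally disjoint (s,t)-paths.
    inner : List (Fin n × Fin n)
    inner = filter inner? (cartesianProduct (allFin n) (allFin n))

    inner⁺ : ∀ {x y} → Arc x y → Other x → Other y → E⟨ inner ⟩ x y
    inner⁺ {x} {y} e ox oy = ∈-filter⁺ inner? (∈-cartesianProduct⁺ (∈-allFin x) (∈-allFin y)) (e , ox , oy)

    inner⁻ : ∀ {x y} → E⟨ inner ⟩ x y → Arc x y × Other x × Other y
    inner⁻ = proj₂ ∘ ∈-filter⁻ inner? {xs = cartesianProduct (allFin n) (allFin n)}

    Source Sink : Pred (Fin n) 0ℓ
    Source v = Arc s v × Other v
    Sink   v = Arc v t × Other v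

    -- `S` may list `s` or `t`, which must survive the deletion, so it is filtered first. A
    -- remaining path from `s` to `t` has a nonempty interior as `s t` is not an arc, and this
    -- interior is a chain from `Source` to `Sink` avoiding `S`.
    not-separating : ¬ Arc s t → ∀ S → StronglyConnectedWithout T (subset (filter other? S)) → ¬ Separates inner Source Sink S
    not-separating ¬st S conn sep
      with conn s t (λ s∈ → proj₁ (other s∈) refl) (λ t∈ → proj₂ (other t∈) refl) s≢t
      where
      other : ∀ {v} → v Subset.∈ subset (filter other? S) → Other v
      other v∈ = proj₂ (∈-filter⁻ other? {xs = S} (∈-subset⁻ (filter other? S) v∈))
    ... | record { interior = int ; linked = linked ; unique = unique } , avoid =
      interior-contradiction int linked unique avoid
      where
      inner-chain : ∀ {u} l → All Other (u ∷ l) → Linked Arc (u ∷ l ∷ʳ t) →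
                    ∃[ y ] Chain E⟨ inner ⟩ u y (u ∷ l) × Sink y
      inner-chain {u} []      (o ∷ [])      (e ∷ [-]) = u , [ u ] , e , o
      inner-chain     (v ∷ l) (o ∷ o′ ∷ os) (e ∷ r) with inner-chain l (o′ ∷ os) r
      ... | y , c , sink = y , inner⁺ e o o′ ∷ c , sink

      interior-contradiction : ∀ l → Linked Arc (s ∷ l ∷ʳ t) → Unique (s ∷ l ∷ʳ t) →
                               All (Subset._∉ subset (filter other? S)) (s ∷ l ∷ʳ t) → ⊥
      interior-contradiction []         (st ∷ [-]) _ _ = ¬st st
      interior-contradiction l@(v ∷ l′) (e ∷ linked) (s≢ ∷ u) (_ ∷ avoid) =
        let y , c , sink = inner-chain l′ other linked
        in sep c (e , All.head other) sink
             (All.tabulate λ w∈ w∈S → All.lookup avoid (∈-++⁺ˡ w∈)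
               (∈-subset⁺ (∈-filter⁺ other? w∈S (All.lookup other w∈))))
        where
        other : All Other l
        other = All.tabulate λ w∈ →
          (λ { refl → All.lookup s≢ (∈-++⁺ˡ w∈) refl }) ,
          (λ { refl → proj₂ (proj₂ (Unique-++⁻ l u)) (w∈ , here refl) })

    toPiece : Link E⟨ inner ⟩ Source Sink → Piece
    toPiece (link c (a , _) (b , _)) = link (chain-map (proj₁ ∘ inner⁻) c) a b

    flat-toPiece : ∀ ps → flat (map toPiece ps) ≡ flat ps
    flat-toPiece []       = refl
    flat-toPiece (p ∷ ps) = cong (verts p ++_) (flat-toPiece ps)

    inner-chain-other : ∀ {x y l} → Chain E⟨ inner ⟩ x y l → Other x → All Other l
    inner-chain-other [ _ ]   o = o ∷ []
    inner-chain-other (e ∷ c) o = o ∷ inner-chain-other c (proj₂ (proj₂ (inner⁻ e)))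

    flat⊆others : ∀ (ps : List (Link E⟨ inner ⟩ Source Sink)) {w} → w ∈ flat ps → w ∈ others
    flat⊆others ps w∈ with ∈-flat⁻ ps w∈
    ... | link c (_ , o) _ , _ , w∈p = ∈-others⁺ (All.lookup (inner-chain-other c o) w∈p)

    spanning-container : ∀ k → ¬ Arc s t →
                         (∀ (S : Subset n) → ∣ S ∣ < 3 + k → StronglyConnectedWithout T S) →
                         Container T (suc k) s t
    spanning-container k ¬st conn
      with menger inner (λ v → arc? s v ×-dec other? v) (λ v → arc? v t ×-dec other? v) (3 + k)
    ... | inj₂ (S , S<k , sep) = ⊥-elim (not-separating ¬st S (conn _ small) sep)
      where
      small : ∣ subset (filter other? S) ∣ < 3 + k
      small = ≤-trans (s≤s (≤-trans (∣subset∣≤length (filter other? S)) (length-filter other? S))) S<k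
    ... | inj₁ (ps , unique , k≤) with unique-⊆⇒↭ unique (flat⊆others ps)
    ...   | W , others↭
      with absorb (λ v → conn ⁅ v ⁆ (≤-trans (s≤s (≤-reflexive (Subset.∣⁅x⁆∣≡1 v))) (s≤s (s≤s z≤n))))
             (length W) (map toPiece ps) W ≤-refl
             (trans (↭-reflexive (cong (_++ W) (flat-toPiece ps))) (↭-sym others↭))
             (≤-trans (s≤s (s≤s (s≤s z≤n))) k≤′)
      where
      k≤′ : 3 + k ≤ length (map toPiece ps)
      k≤′ = ≤-trans k≤ (≤-reflexive (sym (length-map toPiece ps)))
    -- Cancelling two in `3 + k ≤ 2 + length qs` yields the surplus `d` of pieces over `suc k`,
    -- which is then merged away.
    ...     | qs , qs↭ , len with m≤n⇒∃[o]m+o≡n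
                (s≤s⁻¹ (s≤s⁻¹ (≤-trans k≤ (≤-trans (≤-reflexive (sym (length-map toPiece ps))) len))))
    ...       | d , suck+d≡ with reduce d k qs (≡-trans (sym suck+d≡) (+-comm (suc k) d))
                                     (Unique-resp-↭ (↭-sym qs↭) unique-others)
    ...         | rs , rs↭ , len≡ = subst (λ m → Container T m s t) len≡
                  (pieces⇒container rs (trans rs↭ qs↭) (subst (1 ≤_) (sym len≡) (s≤s z≤n)))

-- The connectivity bound and the conclusion.

-- Here `2 ≤ k` enters: the given connectivity covers the `3 + k` paths asked of Menger's theorem.
3+k≤2k+1 : ∀ {k} → 2 ≤ k → 3 + k ≤ 2 * k + 1
3+k≤2k+1 {k} 2≤k = begin
  3 + k           ≡⟨ +-comm 3 k ⟩
  k + (2 + 1)     ≤⟨ +-monoʳ-≤ k (+-monoˡ-≤ 1 2≤k) ⟩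
  k + (k + 1)     ≡⟨ sym (+-assoc k k 1) ⟩
  k + k + 1       ≡⟨ cong (λ m → k + m + 1) (sym (+-identityʳ k)) ⟩
  2 * k + 1       ∎
  where open ≤-Reasoning

theorem3p2 : ∀ (k : ℕ) → 2 ≤ k →
    ∀ (n : ℕ) (T : Digraph n) →
    IsTournament T →
    IsStrong T (2 * k + 1) →
    EveryArcHas2Bypass T →
    IsStarStronglyConnected T (k + 1)
theorem3p2 k 2≤k n T tournament (_ , conn) _ u v u≢v
  rewrite +-comm k 1 with tournament u v u≢v
-- A strong container may run in either direction; the one against the arc forces every path to have
-- an interior.
... | inj₁ (_ , ¬vu) = inj₂ (spanning-container (u≢v ∘ sym) k ¬vu λ S S< → conn S (≤-trans S< (3+k≤2k+1 2≤k)))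
  where open Tournament T tournament; open Between
... | inj₂ (¬uv , _) = inj₁ (spanning-container u≢v k ¬uv λ S S< → conn S (≤-trans S< (3+k≤2k+1 2≤k)))
  where open Tournament T tournament; open Between
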